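{- Let $q$ be an odd prime power, $n$ a positive integer, and $f(x,y,z)=x(y+z)$ viewed as a function from $M_n(\mathbb{F}_q)^3$ to $M_n(\mathbb{F}_q)$. There are constants $C_0,c>0$ (independent of $q$ and the sets) such that for all $A,B,C\subset M_n(\mathbb{F}_q)$ with $|A||B||C|\ge C_0\, q^{3n^2-1}$ we have $|f(A,B,C)|\ge c\, q^{n^2}$.
   Context: $M_n(\mathbb{F}_q)$ is the ring of $n\times n$ matrices over $\mathbb{F}_q$, and $f(A,B,C)=\{a(b+c): a\in A,b\in B,c\in C\}$. -}

module Defs where

open import Level using (0ℓ)
open import Data.Nat using (ℕ; zero; suc; _^_; _≤_)
open import Data.Nat.Primality using (Prime)
open import Data.Fin using (Fin)
open import Data.Vec using (Vec; tabulate; lookup)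
import Data.Vec.Properties as VecP
open import Data.List using (List; length; cartesianProductWith; deduplicate)
open import Data.List.Membership.Propositional using (_∈_)
open import Data.List.Relation.Unary.Unique.Propositional using (Unique)
open import Data.Product using (Σ; ∃; _×_; _,_)
open import Relation.Binary.PropositionalEquality using (_≡_; _≢_)
open import Relation.Binary.Definitions using (DecidableEquality)
open import Algebra.Structures using (IsCommutativeRing)

record FiniteField : Set₁ where
  field
    Carrier  : Set
    _+_ _*_  : Carrier → Carrier → Carrier
    -_       : Carrier → Carrier
    0# 1#    : Carrier
    isCommutativeRing : IsCommutativeRing _≡_ _+_ _*_ -_ 0# 1#
    1≢0      : 1# ≢ 0#
    inverse  : ∀ x → x ≢ 0# → ∃ λ y → x * y ≡ 1#
    _≟_      : DecidableEquality Carrier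
    elements : List Carrier
    elements-unique   : Unique elements
    elements-complete : ∀ x → x ∈ elements

  order : ℕ
  order = length elements

OddPrimePower : ℕ → Set
OddPrimePower q = Σ ℕ λ p → Σ ℕ λ k → Prime p × p ≢ 2 × 1 ≤ k × q ≡ p ^ k

module Matrices (F : FiniteField) where
  open FiniteField F

  Mat : ℕ → Set
  Mat n = Vec (Vec Carrier n) n

  _≟M_ : ∀ {n} → DecidableEquality (Mat n)
  _≟M_ = VecP.≡-dec (VecP.≡-dec _≟_)

  sumF : ∀ {m} → (Fin m → Carrier) → Carrier
  sumF {zero}  g = 0#
  sumF {suc m} g = g Fin.zero + sumF (λ i → g (Fin.suc i))
    where import Data.Fin as Fin

  _+M_ : ∀ {n} → Mat n → Mat n → Mat n
  X +M Y = tabulate λ i → tabulate λ j → lookup (lookup X i) j + lookup (lookup Y i) j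

  _*M_ : ∀ {n} → Mat n → Mat n → Mat n
  X *M Y = tabulate λ i → tabulate λ j →
             sumF (λ k → lookup (lookup X i) k * lookup (lookup Y k) j)

  fMat : ∀ {n} → Mat n → Mat n → Mat n → Mat n
  fMat x y z = x *M (y +M z)

  fImage : ∀ {n} → List (Mat n) → List (Mat n) → List (Mat n) → List (Mat n)
  fImage A B C = deduplicate _≟M_
    (cartesianProductWith (λ a bc → bc a) A
      (cartesianProductWith (λ b c a → fMat a b c) B C))

  ∣fImage∣ : ∀ {n} → List (Mat n) → List (Mat n) → List (Mat n) → ℕ
  ∣fImage∣ A B C = length (fImage A B C)

{-# OPTIONS --safe #-}
module Submission where

open import Defs
open import Data.Nat using (ℕ; _*_; _^_; _≤_; _∸_; NonZero)
open import Data.Integer using (+_)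
open import Data.Rational using (ℚ; Positive; _/_)
import Data.Rational as Q
open import Data.List using (List; length)
open import Data.List.Relation.Unary.Unique.Propositional using (Unique)
open import Data.Product using (Σ; _×_)

open import Level using (0ℓ)
open import Algebra.Bundles using (AbelianGroup; CommutativeRing)
open import Algebra.Structures using (IsAbelianGroup)
open import Data.Bool using (if_then_else_; true; false)
open import Data.Fin as Fin using (Fin; punchIn)
import Data.Integer as ℤ
import Data.Integer.Properties as ℤ
open import Data.List using ([]; _∷_; _++_; map; filter; cartesianProduct; cartesianProductWith; allFin)
open import Data.List.Membership.Propositional using (_∈_; _∉_)
open import Data.List.Membership.Propositional.Properties
open import Data.List.Properties using (map-++; map-∘; map-cong; map-cong-local; length-map; length-++; length-tabulate)
open import Data.List.Relation.Unary.All as All using ([]; _∷_)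
open import Data.List.Relation.Unary.AllPairs using ([]; _∷_)
open import Data.List.Relation.Unary.Any using (here; there)
import Data.List.Relation.Unary.Unique.DecPropositional.Properties as UniqueDec
import Data.List.Relation.Unary.Unique.Propositional.Properties as Unique
import Data.Nat as ℕ
open import Data.Nat using (zero; suc; _+_; z≤n; s≤s; ∣_-_∣; ≢-nonZero; >-nonZero⁻¹)
open import Data.Nat.ListAction using (sum)
open import Data.Nat.ListAction.Properties using (sum-++)
open import Data.Nat.Properties
open import Data.Nat.Tactic.RingSolver using (solve-∀)
open import Data.Product using (_,_; proj₁; proj₂)
open import Data.Rational using (toℚᵘ)
import Data.Rational.Properties as ℚ
import Data.Rational.Unnormalised as ℚᵘ
import Data.Rational.Unnormalised.Properties as ℚᵘ
open import Data.Sum using (inj₁; inj₂)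
open import Data.Vec using (Vec; []; _∷_; lookup; tabulate; insertAt; removeAt)
open import Data.Vec.Properties using (lookup∘tabulate; tabulate∘lookup; tabulate-cong; ∷-injective; insertAt-removeAt; insertAt-punchIn)
open import Function using (_∘_; id)
open import Relation.Binary.Definitions using (DecidableEquality)
open import Relation.Binary.PropositionalEquality
open import Relation.Nullary using (does; yes; no; ¬?; contradiction; _×-dec_)
open import Relation.Unary using (Pred; Decidable)

-- Second moment over lines t = a b + d in M × M, where M = M_n(F_q), Q = q^(n²) and T = f(A,B,C).
-- Let I(a,d) be the number of b ∈ B with a b + d ∈ T; its mean over the Q² lines is |B||T|/Q.
-- Two points (b,t), (b′,t′) lie on at most one common line unless b − b′ is singular, and at
-- most n q^(n²-1) matrices are singular, so the variance of I is small. For invertible a ∈ A and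
-- c ∈ C the lines (a, a c) are distinct and have I = |B|, since a b + a c = f(a,b,c) ∈ T. If
-- |T| ≤ Q/2 this is at least twice the mean, and the variance bound limits |A||B||C| in terms of |T|.

-- Sums over lists

private variable
  X Y : Set

∑ : (X → ℕ) → List X → ℕ
∑ f xs = sum (map f xs)

∑-cong : ∀ {f g : X → ℕ} → (∀ x → f x ≡ g x) → ∀ xs → ∑ f xs ≡ ∑ g xs
∑-cong f≗g xs = cong sum (map-cong f≗g xs)

∑-mono : ∀ {f g : X → ℕ} xs → (∀ {x} → x ∈ xs → f x ≤ g x) → ∑ f xs ≤ ∑ g xs
∑-mono []       f≤g = z≤n
∑-mono (x ∷ xs) f≤g = +-mono-≤ (f≤g (here refl)) (∑-mono xs (f≤g ∘ there))

∑-const : ∀ c (xs : List X) → ∑ (λ _ → c) xs ≡ length xs * c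
∑-const c []       = refl
∑-const c (x ∷ xs) = cong (c ℕ.+_) (∑-const c xs)

∑-distrib-+ : ∀ (f g : X → ℕ) xs → ∑ (λ x → f x + g x) xs ≡ ∑ f xs + ∑ g xs
∑-distrib-+ f g []       = refl
∑-distrib-+ f g (x ∷ xs) =
  trans (cong (f x + g x ℕ.+_) (∑-distrib-+ f g xs)) (interchange (f x) (g x) (∑ f xs) (∑ g xs))
  where
  interchange : ∀ a b c d → a + b + (c + d) ≡ a + c + (b + d)
  interchange = solve-∀

∑-distrib-*ˡ : ∀ c (f : X → ℕ) xs → ∑ (λ x → c * f x) xs ≡ c * ∑ f xs
∑-distrib-*ˡ c f []       = sym (*-zeroʳ c)
∑-distrib-*ˡ c f (x ∷ xs) =
  trans (cong (c * f x ℕ.+_) (∑-distrib-*ˡ c f xs)) (sym (*-distribˡ-+ c (f x) (∑ f xs)))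

∑-comm : ∀ (f : X → Y → ℕ) xs ys →
         ∑ (λ x → ∑ (f x) ys) xs ≡ ∑ (λ y → ∑ (λ x → f x y) xs) ys
∑-comm f []       ys = sym (trans (∑-const 0 ys) (*-zeroʳ (length ys)))
∑-comm f (x ∷ xs) ys =
  trans (cong (∑ (f x) ys ℕ.+_) (∑-comm f xs ys)) (sym (∑-distrib-+ (f x) _ ys))

∑-++ : ∀ (f : X → ℕ) xs ys → ∑ f (xs ++ ys) ≡ ∑ f xs + ∑ f ys
∑-++ f xs ys = trans (cong sum (map-++ f xs ys)) (sum-++ (map f xs) (map f ys))

∑-map : ∀ (f : Y → ℕ) (g : X → Y) xs → ∑ f (map g xs) ≡ ∑ (f ∘ g) xs
∑-map f g xs = cong sum (sym (map-∘ xs))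

∑-cartesianProduct : ∀ (f : X × Y → ℕ) xs ys →
                     ∑ f (cartesianProduct xs ys) ≡ ∑ (λ x → ∑ (λ y → f (x , y)) ys) xs
∑-cartesianProduct f []       ys = refl
∑-cartesianProduct f (x ∷ xs) ys =
  trans (∑-++ f (map (x ,_) ys) _)
        (cong₂ _+_ (∑-map f (x ,_) ys) (∑-cartesianProduct f xs ys))

∑-* : ∀ (f g : X → ℕ) xs ys → ∑ f xs * ∑ g ys ≡ ∑ (λ x → ∑ (λ y → f x * g y) ys) xs
∑-* f g []       ys = refl
∑-* f g (x ∷ xs) ys =
  trans (*-distribʳ-+ (∑ g ys) (f x) (∑ f xs))
        (cong₂ _+_ (sym (∑-distrib-*ˡ (f x) g ys)) (∑-* f g xs ys))

-- Induction on `xs`: one occurrence of the head is cut out of `ys`, and uniqueness guarantees that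
-- the tail still lies in what remains. Repetitions in `ys` only enlarge the right side, so `ys` may
-- be a redundant enumeration such as `singular`.
∑-⊆ : ∀ (f : X → ℕ) {xs ys} → Unique xs → (∀ {x} → x ∈ xs → x ∈ ys) → ∑ f xs ≤ ∑ f ys
∑-⊆ f {[]}     _            _     = z≤n
∑-⊆ f {x ∷ xs} (x∉xs ∷ uxs) xs⊆ys with ps , qs , refl ← ∈-∃++ (xs⊆ys (here refl)) = begin
  f x + ∑ f xs               ≤⟨ +-monoʳ-≤ (f x) (∑-⊆ f uxs xs⊆ps++qs) ⟩
  f x + ∑ f (ps ++ qs)       ≡⟨ cong (f x ℕ.+_) (∑-++ f ps qs) ⟩
  f x + (∑ f ps + ∑ f qs)    ≡⟨ swap (f x) (∑ f ps) (∑ f qs) ⟩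
  ∑ f ps + (f x + ∑ f qs)    ≡⟨ ∑-++ f ps (x ∷ qs) ⟨
  ∑ f (ps ++ x ∷ qs)         ∎
  where
  open ≤-Reasoning
  swap : ∀ a b c → a + (b + c) ≡ b + (a + c)
  swap = solve-∀
  xs⊆ps++qs : ∀ {y} → y ∈ xs → y ∈ ps ++ qs
  xs⊆ps++qs y∈xs with ∈-++⁻ ps (xs⊆ys (there y∈xs))
  ... | inj₁ y∈ps         = ∈-++⁺ˡ y∈ps
  ... | inj₂ (here refl)  = contradiction refl (All.lookup x∉xs y∈xs)
  ... | inj₂ (there y∈qs) = ∈-++⁺ʳ ps y∈qs

-- Comparing lengths of lists

length≡∑1 : ∀ (xs : List X) → length xs ≡ ∑ (λ _ → 1) xs
length≡∑1 xs = sym (trans (∑-const 1 xs) (*-identityʳ (length xs)))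

length-⊆ : ∀ {xs ys : List X} → Unique xs → (∀ {x} → x ∈ xs → x ∈ ys) → length xs ≤ length ys
length-⊆ {xs = xs} {ys} uxs xs⊆ys =
  subst₂ _≤_ (sym (length≡∑1 xs)) (sym (length≡∑1 ys)) (∑-⊆ (λ _ → 1) uxs xs⊆ys)

-- The counting principle behind all the incidence estimates: a set is bounded by encoding its
-- elements injectively in a list of known length.
length-injective : ∀ {φ : X → Y} {xs ys} → Unique xs → (∀ {x y} → φ x ≡ φ y → x ≡ y) →
                   (∀ {x} → x ∈ xs → φ x ∈ ys) → length xs ≤ length ys
length-injective {φ = φ} {xs} {ys} uxs φ-inj φ∈ =
  subst (_≤ length ys) (length-map φ xs) (length-⊆ (Unique.map⁺ φ-inj uxs) map⊆)
  where
  map⊆ : ∀ {y} → y ∈ map φ xs → y ∈ ys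
  map⊆ y∈ with _ , x∈ , refl ← ∈-map⁻ φ y∈ = φ∈ x∈

length-cartesianProductWith : ∀ {Z : Set} (f : X → Y → Z) xs ys →
                              length (cartesianProductWith f xs ys) ≡ length xs * length ys
length-cartesianProductWith f []       ys = refl
length-cartesianProductWith f (x ∷ xs) ys =
  trans (length-++ (map (f x) ys))
        (cong₂ _+_ (length-map (f x) ys) (length-cartesianProductWith f xs ys))

-- Indicator functions

𝟙 : ∀ {P : Pred X 0ℓ} → Decidable P → X → ℕ
𝟙 P? x = if does (P? x) then 1 else 0

∑-𝟙 : ∀ {P : Pred X 0ℓ} (P? : Decidable P) xs → ∑ (𝟙 P?) xs ≡ length (filter P? xs)
∑-𝟙 P? []       = refl
∑-𝟙 P? (x ∷ xs) with does (P? x)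
... | true  = cong suc (∑-𝟙 P? xs)
... | false = ∑-𝟙 P? xs

𝟙≤1 : ∀ {P : Pred X 0ℓ} (P? : Decidable P) x → 𝟙 P? x ≤ 1
𝟙≤1 P? x with does (P? x)
... | true  = s≤s z≤n
... | false = z≤n

𝟙-× : ∀ {P R : Pred X 0ℓ} (P? : Decidable P) (R? : Decidable R) x →
      𝟙 P? x * 𝟙 R? x ≡ 𝟙 (λ y → P? y ×-dec R? y) x
𝟙-× P? R? x with does (P? x) | does (R? x)
... | true  | true  = refl
... | true  | false = refl
... | false | _     = refl

-- The expansion of (x - y)² with the cross term moved to the left, so that the variance can be
-- computed in ℕ.
∣-∣-square : ∀ x y → ∣ x - y ∣ * ∣ x - y ∣ + 2 * (x * y) ≡ x * x + y * y
∣-∣-square zero    y       = +-identityʳ (y * y)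
∣-∣-square (suc x) zero    = cong (suc x * suc x ℕ.+_) (cong (2 *_) (*-zeroʳ x))
∣-∣-square (suc x) (suc y) = begin
  D * D + 2 * (suc x * suc y)        ≡⟨ lhs (D * D) x y ⟩
  (D * D + 2 * (x * y)) + (2 * x + 2 * y + 2) ≡⟨ cong (_+ (2 * x + 2 * y + 2)) (∣-∣-square x y) ⟩
  x * x + y * y + (2 * x + 2 * y + 2) ≡⟨ rhs x y ⟩
  suc x * suc x + suc y * suc y      ∎
  where
  open ≡-Reasoning
  D = ∣ x - y ∣
  lhs : ∀ d x y → d + 2 * ((1 + x) * (1 + y)) ≡ (d + 2 * (x * y)) + (2 * x + 2 * y + 2)
  lhs = solve-∀
  rhs : ∀ x y → x * x + y * y + (2 * x + 2 * y + 2) ≡ (1 + x) * (1 + x) + (1 + y) * (1 + y)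
  rhs = solve-∀

-- Incidences between points and lines

module Incidences
  {M : Set} (_≟_ : DecidableEquality M)
  (_⊕_ _⊛_ : M → M → M) (⊖_ : M → M) (𝟘 : M)
  (isAbelianGroup : IsAbelianGroup _≡_ _⊕_ 𝟘 ⊖_)
  (⊛-distribˡ-⊕ : ∀ x y z → x ⊛ (y ⊕ z) ≡ (x ⊛ y) ⊕ (x ⊛ z))
  (elements : List M) (elements-unique : Unique elements) (elements-complete : ∀ x → x ∈ elements)
  -- Any list that contains all right factors failing to cancel will do; the argument sees only its
  -- length `s`, and repetitions merely make `s` larger.
  (singular : List M)
  (nonsingular-cancel : ∀ {x} → x ∉ singular → ∀ {a a′} → a ⊛ x ≡ a′ ⊛ x → a ≡ a′)
  where

  private
    abelianGroup : AbelianGroup _ _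
    abelianGroup = record { isAbelianGroup = isAbelianGroup }
    open AbelianGroup abelianGroup using (group; assoc; identityʳ; identityˡ; inverseʳ; inverseˡ)
    open import Algebra.Properties.Group group using (∙-cancelˡ; ∙-cancelʳ; ⁻¹-injective)
    open import Data.List.Membership.DecPropositional _≟_ using (_∈?_)

  Q s : ℕ
  Q = length elements
  s = length singular

  lines : List (M × M)
  lines = cartesianProduct elements elements

  ∈-lines : ∀ {ℓ} → ℓ ∈ lines
  ∈-lines {a , d} = ∈-cartesianProduct⁺ (elements-complete a) (elements-complete d)

  lines-unique : Unique lines
  lines-unique = Unique.cartesianProduct⁺ elements-unique elements-unique

  length-lines : length lines ≡ Q * Q
  length-lines = length-cartesianProductWith _,_ elements elements

  infix 25 _at_
  _at_ : M × M → M → M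
  (a , d) at b = (a ⊛ b) ⊕ d

  x⊕⊖x⊕y≡y : ∀ x y → x ⊕ ((⊖ x) ⊕ y) ≡ y
  x⊕⊖x⊕y≡y x y = trans (sym (assoc x (⊖ x) y)) (trans (cong (_⊕ y) (inverseʳ x)) (identityˡ y))

  x⊕⊖y⊕y≡x : ∀ x y → (x ⊕ (⊖ y)) ⊕ y ≡ x
  x⊕⊖y⊕y≡x x y = trans (assoc x (⊖ y) y) (trans (cong (x ⊕_) (inverseˡ y)) (identityʳ x))

  -- By distributivity the two values of a line differ by `a ⊛ δ` with δ = b - b′. Equal values thus
  -- give equal products with δ, cancelling δ gives equal slopes, and then the intercepts agree.
  at-injective : ∀ b b′ → (b ⊕ (⊖ b′)) ∉ singular → ∀ {ℓ ℓ′} →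
                 ℓ at b ≡ ℓ′ at b → ℓ at b′ ≡ ℓ′ at b′ → ℓ ≡ ℓ′
  at-injective b b′ δ∉ {a , d} {a′ , d′} eq eq′ with nonsingular-cancel δ∉ slopes
    where
    δ = b ⊕ (⊖ b′)
    split : ∀ a d → (a , d) at b ≡ (a ⊛ δ) ⊕ (a , d) at b′
    split a d = begin
      (a ⊛ b) ⊕ d                   ≡⟨ cong (λ x → (a ⊛ x) ⊕ d) (x⊕⊖y⊕y≡x b b′) ⟨
      (a ⊛ (δ ⊕ b′)) ⊕ d            ≡⟨ cong (_⊕ d) (⊛-distribˡ-⊕ a δ b′) ⟩
      ((a ⊛ δ) ⊕ (a ⊛ b′)) ⊕ d      ≡⟨ assoc (a ⊛ δ) (a ⊛ b′) d ⟩
      (a ⊛ δ) ⊕ ((a ⊛ b′) ⊕ d)      ∎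
      where open ≡-Reasoning
    slopes : a ⊛ δ ≡ a′ ⊛ δ
    slopes = ∙-cancelʳ ((a′ , d′) at b′) (a ⊛ δ) (a′ ⊛ δ) (begin
      (a ⊛ δ) ⊕ (a′ , d′) at b′   ≡⟨ cong ((a ⊛ δ) ⊕_) eq′ ⟨
      (a ⊛ δ) ⊕ (a , d) at b′     ≡⟨ split a d ⟨
      (a , d) at b                ≡⟨ eq ⟩
      (a′ , d′) at b              ≡⟨ split a′ d′ ⟩
      (a′ ⊛ δ) ⊕ (a′ , d′) at b′  ∎)
      where open ≡-Reasoning
  ... | refl = cong (a ,_) (∙-cancelˡ (a ⊛ b) d d′ eq)

  -- Incidences with a target set T

  module _ (T : List M) (T-unique : Unique T) where

    τ : ℕ
    τ = length T

    χ : M → ℕ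
    χ = 𝟙 (_∈? T)

    χ≤1 : ∀ x → χ x ≤ 1
    χ≤1 = 𝟙≤1 (_∈? T)

    -- For fixed b, the map from (a, d) to (a, a b + d) is a bijection of M × M, so each of the Q
    -- slopes meets each t in T for exactly one intercept. `upper` uses this map and `lower` its
    -- inverse.
    ∑-χ-at : ∀ b → ∑ (λ ℓ → χ (ℓ at b)) lines ≡ Q * τ
    ∑-χ-at b = trans (∑-𝟙 meets? lines) (≤-antisym upper lower)
      where
      meets? : Decidable (λ ℓ → ℓ at b ∈ T)
      meets? ℓ = ℓ at b ∈? T
      upper : length (filter meets? lines) ≤ Q * τ
      upper = subst (length (filter meets? lines) ≤_) (length-cartesianProductWith _,_ elements T)
        (length-injective {φ = λ (a , d) → a , (a , d) at b}
          (Unique.filter⁺ meets? lines-unique) inj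
          (λ ℓ∈ → ∈-cartesianProduct⁺ (elements-complete _) (proj₂ (∈-filter⁻ meets? {xs = lines} ℓ∈))))
        where
        inj : ∀ {ℓ ℓ′ : M × M} → (proj₁ ℓ , ℓ at b) ≡ (proj₁ ℓ′ , ℓ′ at b) → ℓ ≡ ℓ′
        inj {a , d} {a′ , d′} eq with refl ← cong proj₁ eq =
          cong (a ,_) (∙-cancelˡ (a ⊛ b) d d′ (cong proj₂ eq))
      lower : Q * τ ≤ length (filter meets? lines)
      lower = subst (_≤ length (filter meets? lines)) (length-cartesianProductWith _,_ elements T)
        (length-injective {φ = φ} (Unique.cartesianProduct⁺ elements-unique T-unique) inj φ∈)
        where
        φ : M × M → M × M
        φ (a , t) = a , (⊖ (a ⊛ b)) ⊕ t
        inj : ∀ {p p′} → φ p ≡ φ p′ → p ≡ p′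
        inj {a , t} {a′ , t′} eq with refl ← cong proj₁ eq =
          cong (a ,_) (∙-cancelˡ (⊖ (a ⊛ b)) t t′ (cong proj₂ eq))
        φ∈ : ∀ {p} → p ∈ cartesianProduct elements T → φ p ∈ filter meets? lines
        φ∈ {a , t} p∈ = ∈-filter⁺ meets? ∈-lines
          (subst (_∈ T) (sym (x⊕⊖x⊕y≡y (a ⊛ b) t)) (proj₂ (∈-cartesianProduct⁻ elements T p∈)))

    -- A line is determined by its values at b and b′, so the lines counted here embed into T × T.
    ∑-χχ-nonsingular : ∀ b b′ → (b ⊕ (⊖ b′)) ∉ singular →
                       ∑ (λ ℓ → χ (ℓ at b) * χ (ℓ at b′)) lines ≤ τ * τ
    ∑-χχ-nonsingular b b′ δ∉ = begin
      ∑ (λ ℓ → χ (ℓ at b) * χ (ℓ at b′)) lines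
        ≡⟨ ∑-cong (𝟙-× (λ ℓ → ℓ at b ∈? T) (λ ℓ → ℓ at b′ ∈? T)) lines ⟩
      ∑ (𝟙 both?) lines                        ≡⟨ ∑-𝟙 both? lines ⟩
      length (filter both? lines)
        ≤⟨ length-injective {φ = λ ℓ → ℓ at b , ℓ at b′} (Unique.filter⁺ both? lines-unique)
             (λ eq → at-injective b b′ δ∉ (cong proj₁ eq) (cong proj₂ eq))
             (λ ℓ∈ → let (t∈ , t′∈) = proj₂ (∈-filter⁻ both? {xs = lines} ℓ∈) in ∈-cartesianProduct⁺ t∈ t′∈) ⟩
      length (cartesianProduct T T)            ≡⟨ length-cartesianProductWith _,_ T T ⟩
      τ * τ                                    ∎
      where
      open ≤-Reasoning
      both? : Decidable (λ ℓ → ℓ at b ∈ T × ℓ at b′ ∈ T)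
      both? ℓ = (ℓ at b ∈? T) ×-dec (ℓ at b′ ∈? T)

    -- For a singular difference the second indicator is bounded by 1, which leaves the count at the
    -- single point b.
    ∑-χχ : ∀ b b′ → ∑ (λ ℓ → χ (ℓ at b) * χ (ℓ at b′)) lines
                    ≤ τ * τ + Q * τ * 𝟙 (_∈? singular) (b ⊕ (⊖ b′))
    ∑-χχ b b′ with (b ⊕ (⊖ b′)) ∈? singular
    ... | no  δ∉ = ≤-trans (∑-χχ-nonsingular b b′ δ∉) (m≤m+n (τ * τ) _)
    ... | yes _  = begin
      ∑ (λ ℓ → χ (ℓ at b) * χ (ℓ at b′)) lines
        ≤⟨ ∑-mono lines (λ {ℓ} _ → ≤-trans (*-monoʳ-≤ (χ (ℓ at b)) (χ≤1 (ℓ at b′)))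
                                           (≤-reflexive (*-identityʳ _))) ⟩
      ∑ (λ ℓ → χ (ℓ at b)) lines  ≡⟨ ∑-χ-at b ⟩
      Q * τ                       ≡⟨ *-identityʳ (Q * τ) ⟨
      Q * τ * 1                   ≤⟨ m≤n+m (Q * τ * 1) (τ * τ) ⟩
      τ * τ + Q * τ * 1           ∎
      where open ≤-Reasoning

    -- Moments of the incidence count

    module _ (B : List M) (B-unique : Unique B) where

      β : ℕ
      β = length B

      I : M × M → ℕ
      I ℓ = ∑ (λ b → χ (ℓ at b)) B

      ∑-I : ∑ I lines ≡ β * (Q * τ)
      ∑-I = begin
        ∑ I lines                                ≡⟨ ∑-comm (λ ℓ b → χ (ℓ at b)) lines B ⟩
        ∑ (λ b → ∑ (λ ℓ → χ (ℓ at b)) lines) B   ≡⟨ ∑-cong ∑-χ-at B ⟩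
        ∑ (λ _ → Q * τ) B                        ≡⟨ ∑-const (Q * τ) B ⟩
        β * (Q * τ)                              ∎
        where open ≡-Reasoning

      -- For fixed b the difference b - b′ determines b′.
      ∑-singular-differences : ∀ b → ∑ (λ b′ → 𝟙 (_∈? singular) (b ⊕ (⊖ b′))) B ≤ s
      ∑-singular-differences b = subst (_≤ s) (sym (∑-𝟙 δ? B))
        (length-injective {φ = λ b′ → b ⊕ (⊖ b′)} (Unique.filter⁺ δ? B-unique)
          (λ {x} {y} eq → ⁻¹-injective (∙-cancelˡ b (⊖ x) (⊖ y) eq))
          (λ b′∈ → proj₂ (∈-filter⁻ δ? {xs = B} b′∈)))
        where
        δ? : Decidable (λ b′ → (b ⊕ (⊖ b′)) ∈ singular)
        δ? b′ = (b ⊕ (⊖ b′)) ∈? singular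

      -- The square is expanded over pairs (b, b′) and the sum over lines is taken first. The term
      -- β²τ² equals Q² times the squared mean (βτ/Q)² and cancels in `variance`; the rest comes
      -- from pairs with singular difference, at most `s` for each b.
      ∑-I² : ∑ (λ ℓ → I ℓ * I ℓ) lines ≤ β * (β * (τ * τ) + Q * τ * s)
      ∑-I² = begin
        ∑ (λ ℓ → I ℓ * I ℓ) lines
          ≡⟨ ∑-cong (λ ℓ → ∑-* (λ b → χ (ℓ at b)) (λ b → χ (ℓ at b)) B B) lines ⟩
        ∑ (λ ℓ → ∑ (λ b → ∑ (λ b′ → χ (ℓ at b) * χ (ℓ at b′)) B) B) lines
          ≡⟨ ∑-comm _ lines B ⟩
        ∑ (λ b → ∑ (λ ℓ → ∑ (λ b′ → χ (ℓ at b) * χ (ℓ at b′)) B) lines) B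
          ≡⟨ ∑-cong (λ b → ∑-comm _ lines B) B ⟩
        ∑ (λ b → ∑ (λ b′ → ∑ (λ ℓ → χ (ℓ at b) * χ (ℓ at b′)) lines) B) B
          ≤⟨ ∑-mono B (λ {b} _ → ∑-mono B (λ {b′} _ → ∑-χχ b b′)) ⟩
        ∑ (λ b → ∑ (λ b′ → τ * τ + Q * τ * 𝟙 (_∈? singular) (b ⊕ (⊖ b′))) B) B
          ≤⟨ ∑-mono B (λ {b} _ → row b) ⟩
        ∑ (λ _ → β * (τ * τ) + Q * τ * s) B
          ≡⟨ ∑-const _ B ⟩
        β * (β * (τ * τ) + Q * τ * s) ∎
        where
        open ≤-Reasoning
        row : ∀ b → ∑ (λ b′ → τ * τ + Q * τ * 𝟙 (_∈? singular) (b ⊕ (⊖ b′))) B ≤ β * (τ * τ) + Q * τ * s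
        row b = begin
          ∑ (λ b′ → τ * τ + Q * τ * 𝟙 (_∈? singular) (b ⊕ (⊖ b′))) B
            ≡⟨ ∑-distrib-+ (λ _ → τ * τ) (λ b′ → Q * τ * 𝟙 (_∈? singular) (b ⊕ (⊖ b′))) B ⟩
          ∑ (λ _ → τ * τ) B + ∑ (λ b′ → Q * τ * 𝟙 (_∈? singular) (b ⊕ (⊖ b′))) B
            ≡⟨ cong₂ _+_ (∑-const (τ * τ) B) (∑-distrib-*ˡ (Q * τ) _ B) ⟩
          β * (τ * τ) + Q * τ * ∑ (λ b′ → 𝟙 (_∈? singular) (b ⊕ (⊖ b′))) B
            ≤⟨ +-monoʳ-≤ (β * (τ * τ)) (*-monoʳ-≤ (Q * τ) (∑-singular-differences b)) ⟩
          β * (τ * τ) + Q * τ * s ∎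

      -- The squared deviation of `I` from its mean βτ/Q, multiplied by Q² to remain in ℕ.
      deviation² : M × M → ℕ
      deviation² ℓ = ∣ Q * I ℓ - β * τ ∣ * ∣ Q * I ℓ - β * τ ∣

      variance : ∑ deviation² lines ≤ Q * Q * (β * (Q * τ * s))
      -- Twice Q²(βτ)² is added to both sides: by `∑-I` this is exactly the sum of the cross terms,
      -- which complete each `deviation²` to a sum of two squares.
      variance = +-cancelʳ-≤ (2 * (Q * Q * (β * τ * (β * τ)))) _ _ (begin
        V + 2 * (Q * Q * (P * P))                            ≡⟨ cong (V ℕ.+_) (e₁ Q P) ⟩
        V + 2 * (Q * P) * (Q * P)                            ≡⟨ cong (λ x → V + 2 * (Q * P) * x) (trans ∑-I (sym (e₀ β Q τ))) ⟨
        V + 2 * (Q * P) * ∑ I lines                          ≡⟨ cong (V ℕ.+_) (∑-distrib-*ˡ (2 * (Q * P)) I lines) ⟨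
        V + ∑ (λ ℓ → 2 * (Q * P) * I ℓ) lines                ≡⟨ ∑-distrib-+ deviation² _ lines ⟨
        ∑ (λ ℓ → deviation² ℓ + 2 * (Q * P) * I ℓ) lines     ≡⟨ ∑-cong expand lines ⟩
        ∑ (λ ℓ → Q * Q * (I ℓ * I ℓ) + P * P) lines          ≡⟨ ∑-distrib-+ _ (λ _ → P * P) lines ⟩
        ∑ (λ ℓ → Q * Q * (I ℓ * I ℓ)) lines + ∑ (λ _ → P * P) lines
          ≡⟨ cong₂ _+_ (∑-distrib-*ˡ (Q * Q) _ lines) (trans (∑-const (P * P) lines) (cong (_* (P * P)) length-lines)) ⟩
        Q * Q * ∑ (λ ℓ → I ℓ * I ℓ) lines + Q * Q * (P * P)  ≤⟨ +-monoˡ-≤ _ (*-monoʳ-≤ (Q * Q) ∑-I²) ⟩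
        Q * Q * (β * (β * (τ * τ) + Q * τ * s)) + Q * Q * (P * P) ≡⟨ e₂ Q β τ s ⟩
        Q * Q * (β * (Q * τ * s)) + 2 * (Q * Q * (P * P))    ∎)
        where
        open ≤-Reasoning
        P V : ℕ
        P = β * τ
        V = ∑ deviation² lines
        e₀ : ∀ b q t → q * (b * t) ≡ b * (q * t)
        e₀ = solve-∀
        e₁ : ∀ q p → 2 * (q * q * (p * p)) ≡ 2 * (q * p) * (q * p)
        e₁ = solve-∀
        e₂ : ∀ q b t s → q * q * (b * (b * (t * t) + q * t * s)) + q * q * (b * t * (b * t))
                       ≡ q * q * (b * (q * t * s)) + 2 * (q * q * (b * t * (b * t)))
        e₂ = solve-∀
        e₃ : ∀ q p i → 2 * (q * p) * i ≡ 2 * (q * i * p)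
        e₃ = solve-∀
        e₄ : ∀ q p i → q * i * (q * i) + p * p ≡ q * q * (i * i) + p * p
        e₄ = solve-∀
        expand : ∀ ℓ → deviation² ℓ + 2 * (Q * P) * I ℓ ≡ Q * Q * (I ℓ * I ℓ) + P * P
        expand ℓ = trans (cong (deviation² ℓ ℕ.+_) (e₃ Q P (I ℓ)))
                         (trans (∣-∣-square (Q * I ℓ) P) (e₄ Q P (I ℓ)))

      -- On such a line the scaled count is Qβ while the scaled mean βτ is at most Qβ/2, so the
      -- distance is at least Qβ/2; squaring yields the factor 4.
      deviation-rich : ∀ {ℓ} → I ℓ ≡ β → 2 * τ ≤ Q → Q * β * (Q * β) ≤ 4 * deviation² ℓ
      deviation-rich {ℓ} Iℓ≡β 2τ≤Q = begin
        Q * β * (Q * β)     ≤⟨ *-mono-≤ half half ⟩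
        2 * D * (2 * D)     ≡⟨ e D ⟩
        4 * (D * D)         ∎
        where
        open ≤-Reasoning
        D = ∣ Q * I ℓ - β * τ ∣
        e : ∀ d → 2 * d * (2 * d) ≡ 4 * (d * d)
        e = solve-∀
        e′ : ∀ q b t → b * (2 * t) + (q * b) ≡ 2 * (b * t) + q * b
        e′ = solve-∀
        e″ : ∀ b q → b * q + q * b ≡ 2 * (q * b)
        e″ = solve-∀
        half : Q * β ≤ 2 * D
        half = +-cancelˡ-≤ (2 * (β * τ)) _ _ (begin
          2 * (β * τ) + Q * β    ≡⟨ e′ Q β τ ⟨
          β * (2 * τ) + Q * β    ≤⟨ +-monoˡ-≤ (Q * β) (*-monoʳ-≤ β 2τ≤Q) ⟩
          β * Q + Q * β          ≡⟨ e″ β Q ⟩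
          2 * (Q * β)            ≡⟨ cong (λ i → 2 * (Q * i)) Iℓ≡β ⟨
          2 * (Q * I ℓ)          ≤⟨ *-monoʳ-≤ 2 (m≤n+∣m-n∣ (Q * I ℓ) (β * τ)) ⟩
          2 * (β * τ + D)        ≡⟨ *-distribˡ-+ 2 (β * τ) D ⟩
          2 * (β * τ) + 2 * D    ∎)

      -- Rich lines

      module _ (A C : List M) (A-unique : Unique A) (C-unique : Unique C)
        (A-cancel : ∀ {a} → a ∈ A → ∀ {c c′} → a ⊛ c ≡ a ⊛ c′ → c ≡ c′)
        (image : ∀ {a b c} → a ∈ A → b ∈ B → c ∈ C → a ⊛ (b ⊕ c) ∈ T) where

        rich : ∀ {a c} → a ∈ A → c ∈ C → I (a , a ⊛ c) ≡ β
        rich {a} {c} a∈ c∈ =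
          trans (cong sum (map-cong-local (All.tabulate meets)))
                (trans (∑-const 1 B) (*-identityʳ β))
          where
          meets : ∀ {b} → b ∈ B → χ ((a , a ⊛ c) at b) ≡ 1
          meets {b} b∈ with (a , a ⊛ c) at b ∈? T
          ... | yes _ = refl
          ... | no ∉T = contradiction (subst (_∈ T) (⊛-distribˡ-⊕ a b c) (image a∈ b∈ c∈)) ∉T

        -- By `A-cancel` the intercept `a ⊛ c` determines c once a is fixed, so no line is counted
        -- twice on the left.
        rich-lines : ∀ (f : M × M → ℕ) → ∑ (λ a → ∑ (λ c → f (a , a ⊛ c)) C) A ≤ ∑ f lines
        rich-lines f = begin
          ∑ (λ a → ∑ (λ c → f (a , a ⊛ c)) C) A
            ≤⟨ ∑-mono A (λ {a} a∈ → ≤-trans (≤-reflexive (sym (∑-map (λ d → f (a , d)) (a ⊛_) C)))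
                 (∑-⊆ (λ d → f (a , d)) (Unique.map⁺ (A-cancel a∈) C-unique) (λ _ → elements-complete _))) ⟩
          ∑ (λ a → ∑ (λ d → f (a , d)) elements) A
            ≤⟨ ∑-⊆ _ A-unique (λ _ → elements-complete _) ⟩
          ∑ (λ a → ∑ (λ d → f (a , d)) elements) elements
            ≡⟨ ∑-cartesianProduct f elements elements ⟨
          ∑ f lines ∎
          where open ≤-Reasoning

        -- Each of the |A||C| distinct rich lines contributes at least (Qβ)²/4 to the total
        -- deviation, which `variance` bounds.
        image-bound : 2 * τ ≤ Q →
          length A * (length C * (Q * β * (Q * β))) ≤ 4 * (Q * Q * (β * (Q * τ * s)))
        image-bound 2τ≤Q = begin
          length A * (length C * (Q * β * (Q * β)))
            ≡⟨ trans (∑-cong (λ _ → ∑-const _ C) A) (∑-const _ A) ⟨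
          ∑ (λ a → ∑ (λ c → Q * β * (Q * β)) C) A
            ≤⟨ ∑-mono A (λ {a} a∈ → ∑-mono C (λ {c} c∈ → deviation-rich {a , a ⊛ c} (rich a∈ c∈) 2τ≤Q)) ⟩
          ∑ (λ a → ∑ (λ c → 4 * deviation² (a , a ⊛ c)) C) A
            ≤⟨ rich-lines (λ ℓ → 4 * deviation² ℓ) ⟩
          ∑ (λ ℓ → 4 * deviation² ℓ) lines
            ≡⟨ ∑-distrib-*ˡ 4 deviation² lines ⟩
          4 * ∑ deviation² lines
            ≤⟨ *-monoʳ-≤ 4 variance ⟩
          4 * (Q * Q * (β * (Q * τ * s))) ∎
          where open ≤-Reasoning

-- Matrices over a finite field

vectors : List X → ∀ k → List (Vec X k)
vectors xs zero    = [] ∷ []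
vectors xs (suc k) = cartesianProductWith _∷_ xs (vectors xs k)

length-vectors : ∀ (xs : List X) k → length (vectors xs k) ≡ length xs ^ k
length-vectors xs zero    = refl
length-vectors xs (suc k) =
  trans (length-cartesianProductWith _∷_ xs (vectors xs k)) (cong (length xs *_) (length-vectors xs k))

vectors-unique : ∀ {xs : List X} → Unique xs → ∀ k → Unique (vectors xs k)
vectors-unique uxs zero    = [] ∷ []
vectors-unique uxs (suc k) = Unique.cartesianProductWith⁺ _∷_ ∷-injective uxs (vectors-unique uxs k)

vectors-complete : ∀ {xs : List X} → (∀ x → x ∈ xs) → ∀ {k} (v : Vec X k) → v ∈ vectors xs k
vectors-complete c []      = here refl
vectors-complete c (x ∷ v) = ∈-cartesianProductWith⁺ _∷_ (c x) (vectors-complete c v)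

lookup-ext : ∀ {k} {u v : Vec X k} → (∀ i → lookup u i ≡ lookup v i) → u ≡ v
lookup-ext {u = u} {v} eq = trans (sym (tabulate∘lookup u)) (trans (tabulate-cong eq) (tabulate∘lookup v))

lookup-removeAt : ∀ {k} (v : Vec X (suc k)) i j → lookup (removeAt v i) j ≡ lookup v (punchIn i j)
lookup-removeAt v i j = trans (sym (insertAt-punchIn (removeAt v i) i (lookup v i) j))
                              (cong (λ w → lookup w (punchIn i j)) (insertAt-removeAt v i))

module MatrixAlgebra (F : FiniteField) where
  open FiniteField F using (Carrier; isCommutativeRing; inverse; elements; elements-unique; elements-complete; order)
    renaming (_≟_ to _≟ᶠ_)
  open Matrices F

  R : CommutativeRing 0ℓ 0ℓ
  R = record { isCommutativeRing = isCommutativeRing }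

  open CommutativeRing R using (ring; semiring; 0#; 1#; -_; distribˡ; -‿inverseˡ)
    renaming ( _+_ to _+ᶠ_; _*_ to _*ᶠ_; _-_ to _-ᶠ_; *-assoc to *ᶠ-assoc; *-comm to *ᶠ-comm
             ; +-assoc to +ᶠ-assoc; +-comm to +ᶠ-comm; +-identityˡ to +ᶠ-identityˡ; +-identityʳ to +ᶠ-identityʳ
             ; *-identityˡ to *ᶠ-identityˡ; distribʳ to distribʳᶠ)
  open import Algebra.Properties.Ring ring using (-‿distribˡ-*; -‿distribʳ-*; -‿involutive; x∙y⁻¹≈ε⇒x≈y; +-inverseˡ-unique)
  open import Algebra.Properties.Semiring.Sum semiring using (sum-remove; *-distribˡ-sum; sum-cong-≗)
    renaming (sum to sumᶠ; ∑-distrib-+ to sumᶠ-distrib-+)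

  -- Makes the library's laws of finite sums available for matrix products.
  sumF≡sum : ∀ {k} (f : Fin k → Carrier) → sumF f ≡ sumᶠ f
  sumF≡sum {zero}  f = refl
  sumF≡sum {suc k} f = cong (f Fin.zero +ᶠ_) (sumF≡sum (f ∘ Fin.suc))

  -- Matrix arithmetic and enumeration

  module _ {n : ℕ} where

    infix 30 _⟨_,_⟩
    _⟨_,_⟩ : Mat n → Fin n → Fin n → Carrier
    X ⟨ i , j ⟩ = lookup (lookup X i) j

    matrix : (Fin n → Fin n → Carrier) → Mat n
    matrix f = tabulate λ i → tabulate (f i)

    entry : ∀ f i j → matrix f ⟨ i , j ⟩ ≡ f i j
    entry f i j = trans (cong (λ r → lookup r j) (lookup∘tabulate (λ i → tabulate (f i)) i))
                        (lookup∘tabulate (f i) j)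

    entry-ext : ∀ {X Y : Mat n} → (∀ i j → X ⟨ i , j ⟩ ≡ Y ⟨ i , j ⟩) → X ≡ Y
    entry-ext eq = lookup-ext λ i → lookup-ext (eq i)

    *M-entry : ∀ (X Y : Mat n) i j → (X *M Y) ⟨ i , j ⟩ ≡ sumᶠ (λ k → X ⟨ i , k ⟩ *ᶠ Y ⟨ k , j ⟩)
    *M-entry X Y i j = trans (entry (λ i j → sumF λ k → X ⟨ i , k ⟩ *ᶠ Y ⟨ k , j ⟩) i j) (sumF≡sum λ k → X ⟨ i , k ⟩ *ᶠ Y ⟨ k , j ⟩)

    +M-entry : ∀ (X Y : Mat n) i j → (X +M Y) ⟨ i , j ⟩ ≡ X ⟨ i , j ⟩ +ᶠ Y ⟨ i , j ⟩
    +M-entry X Y = entry λ i j → X ⟨ i , j ⟩ +ᶠ Y ⟨ i , j ⟩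

    -M_ : Mat n → Mat n
    -M X = matrix λ i j → - (X ⟨ i , j ⟩)

    0M : Mat n
    0M = matrix λ _ _ → 0#

    _ᵀ : Mat n → Mat n
    X ᵀ = matrix λ i j → X ⟨ j , i ⟩

    +M-assoc : ∀ X Y Z → (X +M Y) +M Z ≡ X +M (Y +M Z)
    +M-assoc X Y Z = entry-ext λ i j → begin
      ((X +M Y) +M Z) ⟨ i , j ⟩                        ≡⟨ +M-entry (X +M Y) Z i j ⟩
      (X +M Y) ⟨ i , j ⟩ +ᶠ Z ⟨ i , j ⟩                ≡⟨ cong (_+ᶠ Z ⟨ i , j ⟩) (+M-entry X Y i j) ⟩
      (X ⟨ i , j ⟩ +ᶠ Y ⟨ i , j ⟩) +ᶠ Z ⟨ i , j ⟩      ≡⟨ +ᶠ-assoc _ _ _ ⟩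
      X ⟨ i , j ⟩ +ᶠ (Y ⟨ i , j ⟩ +ᶠ Z ⟨ i , j ⟩)      ≡⟨ cong (X ⟨ i , j ⟩ +ᶠ_) (+M-entry Y Z i j) ⟨
      X ⟨ i , j ⟩ +ᶠ (Y +M Z) ⟨ i , j ⟩                ≡⟨ +M-entry X (Y +M Z) i j ⟨
      (X +M (Y +M Z)) ⟨ i , j ⟩                        ∎
      where open ≡-Reasoning

    +M-comm : ∀ X Y → X +M Y ≡ Y +M X
    +M-comm X Y = entry-ext λ i j →
      trans (+M-entry X Y i j) (trans (+ᶠ-comm _ _) (sym (+M-entry Y X i j)))

    +M-identityˡ : ∀ X → 0M +M X ≡ X
    +M-identityˡ X = entry-ext λ i j →
      trans (+M-entry 0M X i j) (trans (cong (_+ᶠ X ⟨ i , j ⟩) (entry _ i j)) (+ᶠ-identityˡ _))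

    +M-inverseˡ : ∀ X → (-M X) +M X ≡ 0M
    +M-inverseˡ X = entry-ext λ i j → begin
      ((-M X) +M X) ⟨ i , j ⟩               ≡⟨ +M-entry (-M X) X i j ⟩
      (-M X) ⟨ i , j ⟩ +ᶠ X ⟨ i , j ⟩       ≡⟨ cong (_+ᶠ X ⟨ i , j ⟩) (entry _ i j) ⟩
      (- (X ⟨ i , j ⟩)) +ᶠ X ⟨ i , j ⟩      ≡⟨ -‿inverseˡ _ ⟩
      0#                                    ≡⟨ entry _ i j ⟨
      0M ⟨ i , j ⟩                          ∎
      where open ≡-Reasoning

    +M-isAbelianGroup : IsAbelianGroup _≡_ _+M_ 0M -M_
    +M-isAbelianGroup = record
      { isGroup = record
        { isMonoid = record
          { isSemigroup = record
            { isMagma = record { isEquivalence = isEquivalence ; ∙-cong = cong₂ _+M_ }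
            ; assoc   = +M-assoc
            }
          ; identity = +M-identityˡ , λ X → trans (+M-comm X 0M) (+M-identityˡ X)
          }
        ; inverse = +M-inverseˡ , λ X → trans (+M-comm X (-M X)) (+M-inverseˡ X)
        ; ⁻¹-cong = cong -M_
        }
      ; comm = +M-comm
      }

    *M-distribˡ-+M : ∀ X Y Z → X *M (Y +M Z) ≡ (X *M Y) +M (X *M Z)
    *M-distribˡ-+M X Y Z = entry-ext λ i j → begin
      (X *M (Y +M Z)) ⟨ i , j ⟩
        ≡⟨ *M-entry X (Y +M Z) i j ⟩
      sumᶠ (λ k → X ⟨ i , k ⟩ *ᶠ (Y +M Z) ⟨ k , j ⟩)
        ≡⟨ sum-cong-≗ (λ k → trans (cong (X ⟨ i , k ⟩ *ᶠ_) (+M-entry Y Z k j)) (distribˡ _ _ _)) ⟩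
      sumᶠ (λ k → (X ⟨ i , k ⟩ *ᶠ Y ⟨ k , j ⟩) +ᶠ (X ⟨ i , k ⟩ *ᶠ Z ⟨ k , j ⟩))
        ≡⟨ sumᶠ-distrib-+ (λ k → X ⟨ i , k ⟩ *ᶠ Y ⟨ k , j ⟩) (λ k → X ⟨ i , k ⟩ *ᶠ Z ⟨ k , j ⟩) ⟩
      sumᶠ (λ k → X ⟨ i , k ⟩ *ᶠ Y ⟨ k , j ⟩) +ᶠ sumᶠ (λ k → X ⟨ i , k ⟩ *ᶠ Z ⟨ k , j ⟩)
        ≡⟨ cong₂ _+ᶠ_ (*M-entry X Y i j) (*M-entry X Z i j) ⟨
      (X *M Y) ⟨ i , j ⟩ +ᶠ (X *M Z) ⟨ i , j ⟩
        ≡⟨ +M-entry (X *M Y) (X *M Z) i j ⟨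
      ((X *M Y) +M (X *M Z)) ⟨ i , j ⟩ ∎
      where open ≡-Reasoning

    ᵀ-involutive : ∀ X → (X ᵀ) ᵀ ≡ X
    ᵀ-involutive X = entry-ext λ i j → trans (entry _ i j) (entry _ j i)

    ᵀ-injective : ∀ {X Y} → X ᵀ ≡ Y ᵀ → X ≡ Y
    ᵀ-injective {X} {Y} eq = trans (sym (ᵀ-involutive X)) (trans (cong _ᵀ eq) (ᵀ-involutive Y))

    ᵀ-*M : ∀ X Y → (X *M Y) ᵀ ≡ (Y ᵀ) *M (X ᵀ)
    ᵀ-*M X Y = entry-ext λ i j → begin
      ((X *M Y) ᵀ) ⟨ i , j ⟩                             ≡⟨ entry _ i j ⟩
      (X *M Y) ⟨ j , i ⟩                                 ≡⟨ *M-entry X Y j i ⟩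
      sumᶠ (λ k → X ⟨ j , k ⟩ *ᶠ Y ⟨ k , i ⟩)
        ≡⟨ sum-cong-≗ (λ k → trans (*ᶠ-comm _ _) (sym (cong₂ _*ᶠ_ (entry _ i k) (entry _ k j)))) ⟩
      sumᶠ (λ k → (Y ᵀ) ⟨ i , k ⟩ *ᶠ (X ᵀ) ⟨ k , j ⟩)    ≡⟨ *M-entry (Y ᵀ) (X ᵀ) i j ⟨
      ((Y ᵀ) *M (X ᵀ)) ⟨ i , j ⟩                         ∎
      where open ≡-Reasoning

    matrices : List (Mat n)
    matrices = vectors (vectors elements n) n

    matrices-unique : Unique matrices
    matrices-unique = vectors-unique (vectors-unique elements-unique n) n

    matrices-complete : ∀ X → X ∈ matrices
    matrices-complete = vectors-complete (vectors-complete elements-complete)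

    length-matrices : length matrices ≡ order ^ (n * n)
    length-matrices = trans (length-vectors (vectors elements n) n)
      (trans (cong (_^ n) (length-vectors elements n)) (^-*-assoc order n n))

  -- Singular matrices and cancellation

  module _ {m : ℕ} where

    combination : Vec Carrier m → Vec (Vec Carrier (suc m)) m → Vec Carrier (suc m)
    combination cs rows = tabulate λ j → sumᶠ λ i → lookup cs i *ᶠ lookup (lookup rows i) j

    withDependentRow : Fin (suc m) → Vec Carrier m × Vec (Vec Carrier (suc m)) m → Mat (suc m)
    withDependentRow k (cs , rows) = insertAt rows k (combination cs rows)

    -- Covers every matrix with a nonzero left kernel vector v: if v k ≢ 0#, row k is a combination
    -- of the others. Matrices may be listed repeatedly.
    singular : List (Mat (suc m))
    singular = cartesianProductWith withDependentRow (allFin (suc m))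
      (cartesianProduct (vectors elements m) (vectors (vectors elements (suc m)) m))

    -- With n = `suc m` the exponent is n² - 1: m coefficients and m free rows of length n. The
    -- factor `suc m` counts the positions of the dependent row.
    length-singular : length singular ≡ suc m * order ^ (m + suc m * m)
    length-singular = begin
      length singular
        ≡⟨ length-cartesianProductWith withDependentRow (allFin (suc m)) choices ⟩
      length (allFin (suc m)) * length choices
        ≡⟨ cong₂ _*_ (length-tabulate {n = suc m} id) (length-cartesianProductWith _,_ (vectors elements m) _) ⟩
      suc m * (length (vectors elements m) * length (vectors (vectors elements (suc m)) m))
        ≡⟨ cong (suc m *_) (cong₂ _*_ (length-vectors elements m)
             (trans (length-vectors (vectors elements (suc m)) m) (cong (_^ m) (length-vectors elements (suc m))))) ⟩
      suc m * (order ^ m * (order ^ suc m) ^ m)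
        ≡⟨ cong (λ x → suc m * (order ^ m * x)) (^-*-assoc order (suc m) m) ⟩
      suc m * (order ^ m * order ^ (suc m * m))
        ≡⟨ cong (suc m *_) (^-distribˡ-+-* order m (suc m * m)) ⟨
      suc m * order ^ (m + suc m * m) ∎
      where
      open ≡-Reasoning
      choices = cartesianProduct (vectors elements m) (vectors (vectors elements (suc m)) m)

    solve-for : ∀ {v w x y} → v *ᶠ w ≡ 1# → (v *ᶠ x) +ᶠ y ≡ 0# → x ≡ (- w) *ᶠ y
    solve-for {v} {w} {x} {y} vw≡1 eq = sym (begin
      (- w) *ᶠ y                 ≡⟨ cong ((- w) *ᶠ_) (+-inverseˡ-unique y (v *ᶠ x) (trans (+ᶠ-comm y (v *ᶠ x)) eq)) ⟩
      (- w) *ᶠ (- (v *ᶠ x))      ≡⟨ -‿distribˡ-* w _ ⟨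
      - (w *ᶠ (- (v *ᶠ x)))      ≡⟨ cong -_ (-‿distribʳ-* w _) ⟨
      - (- (w *ᶠ (v *ᶠ x)))      ≡⟨ -‿involutive _ ⟩
      w *ᶠ (v *ᶠ x)              ≡⟨ *ᶠ-assoc w v x ⟨
      (w *ᶠ v) *ᶠ x              ≡⟨ cong (_*ᶠ x) (trans (*ᶠ-comm w v) vw≡1) ⟩
      1# *ᶠ x                    ≡⟨ *ᶠ-identityˡ x ⟩
      x                          ∎)
      where open ≡-Reasoning

    -- Multiplying the relation v X = 0 by the inverse w of `v k` expresses row k through the other
    -- rows, with coefficients -w v. This takes the place of determinants.
    kernel⇒singular : ∀ (X : Mat (suc m)) (v : Fin (suc m) → Carrier) k → v k ≢ 0# →
                      (∀ j → sumᶠ (λ l → v l *ᶠ X ⟨ l , j ⟩) ≡ 0#) → X ∈ singular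
    kernel⇒singular X v k vk≢0 vX≡0 with w , vw≡1 ← inverse (v k) vk≢0 =
      subst (_∈ singular) (trans (cong (insertAt rows k) row-k) (insertAt-removeAt X k))
        (∈-cartesianProductWith⁺ withDependentRow (∈-allFin k)
          (∈-cartesianProduct⁺ (vectors-complete elements-complete cs)
                               (vectors-complete (vectors-complete elements-complete) rows)))
      where
      open ≡-Reasoning
      rows = removeAt X k
      cs = tabulate λ l → (- w) *ᶠ v (punchIn k l)
      row-k : combination cs rows ≡ lookup X k
      row-k = lookup-ext λ j → begin
        lookup (combination cs rows) j
          ≡⟨ lookup∘tabulate (λ j → sumᶠ λ l → lookup cs l *ᶠ lookup (lookup rows l) j) j ⟩
        sumᶠ (λ l → lookup cs l *ᶠ lookup (lookup rows l) j)
          ≡⟨ sum-cong-≗ (λ l → trans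
               (cong₂ _*ᶠ_ (lookup∘tabulate _ l) (cong (λ r → lookup r j) (lookup-removeAt X k l)))
               (*ᶠ-assoc (- w) (v (punchIn k l)) (X ⟨ punchIn k l , j ⟩))) ⟩
        sumᶠ (λ l → (- w) *ᶠ (v (punchIn k l) *ᶠ X ⟨ punchIn k l , j ⟩))
          ≡⟨ *-distribˡ-sum (- w) (λ l → v (punchIn k l) *ᶠ X ⟨ punchIn k l , j ⟩) ⟨
        (- w) *ᶠ sumᶠ (λ l → v (punchIn k l) *ᶠ X ⟨ punchIn k l , j ⟩)
          ≡⟨ solve-for vw≡1 (trans (sym (sum-remove {i = k} (λ l → v l *ᶠ X ⟨ l , j ⟩))) (vX≡0 j)) ⟨
        X ⟨ k , j ⟩ ∎

    x-y+y≡x : ∀ x y → (x -ᶠ y) +ᶠ y ≡ x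
    x-y+y≡x x y = trans (+ᶠ-assoc x (- y) y) (trans (cong (x +ᶠ_) (-‿inverseˡ y)) (+ᶠ-identityʳ x))

    -- If A and A′ differ at (i, k), then row i of A - A′ is a left kernel vector of X with nonzero
    -- entry k, which puts X into `singular`.
    nonsingular-cancelʳ : ∀ {X : Mat (suc m)} → X ∉ singular → ∀ {A A′} → A *M X ≡ A′ *M X → A ≡ A′
    nonsingular-cancelʳ {X} X∉ {A} {A′} eq = entry-ext λ i k → equal i k
      where
      equal : ∀ i k → A ⟨ i , k ⟩ ≡ A′ ⟨ i , k ⟩
      equal i k with A ⟨ i , k ⟩ ≟ᶠ A′ ⟨ i , k ⟩
      ... | yes p = p
      ... | no ¬p = contradiction (kernel⇒singular X v k (¬p ∘ x∙y⁻¹≈ε⇒x≈y _ _) vX≡0) X∉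
        where
        v = λ l → A ⟨ i , l ⟩ -ᶠ A′ ⟨ i , l ⟩
        row : Mat (suc m) → Fin (suc m) → Carrier
        row Z j = sumᶠ λ l → Z ⟨ i , l ⟩ *ᶠ X ⟨ l , j ⟩
        -- Adding the row of A′X and cancelling it afterwards avoids distributing the negation over
        -- the sum.
        v+A′≡A : ∀ j → sumᶠ (λ l → v l *ᶠ X ⟨ l , j ⟩) +ᶠ row A′ j ≡ row A j
        v+A′≡A j = trans (sym (sumᶠ-distrib-+ (λ l → v l *ᶠ X ⟨ l , j ⟩) (λ l → A′ ⟨ i , l ⟩ *ᶠ X ⟨ l , j ⟩)))
          (sum-cong-≗ λ l → trans (sym (distribʳᶠ (X ⟨ l , j ⟩) (v l) (A′ ⟨ i , l ⟩)))
            (cong (_*ᶠ X ⟨ l , j ⟩) (x-y+y≡x (A ⟨ i , l ⟩) (A′ ⟨ i , l ⟩))))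
        row-eq : ∀ j → row A j ≡ row A′ j
        row-eq j = trans (sym (*M-entry A X i j)) (trans (cong (_⟨ i , j ⟩) eq) (*M-entry A′ X i j))
        open import Algebra.Properties.Group (CommutativeRing.+-group R) using (∙-cancelʳ)
        vX≡0 : ∀ j → sumᶠ (λ l → v l *ᶠ X ⟨ l , j ⟩) ≡ 0#
        vX≡0 j = ∙-cancelʳ (row A′ j) _ 0#
          (trans (v+A′≡A j) (trans (row-eq j) (sym (+ᶠ-identityˡ _))))

    -- Transposition exchanges the two sides of a product, so the same list `singular` serves for
    -- cancellation on the left.
    nonsingularᵀ-cancelˡ : ∀ {X : Mat (suc m)} → X ᵀ ∉ singular → ∀ {A A′} → X *M A ≡ X *M A′ → A ≡ A′
    nonsingularᵀ-cancelˡ {X} Xᵀ∉ {A} {A′} eq = ᵀ-injective (nonsingular-cancelʳ Xᵀ∉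
      (trans (sym (ᵀ-*M X A)) (trans (cong _ᵀ eq) (ᵀ-*M X A′))))

-- Conclusion

length-filter-split : ∀ {P : Pred X 0ℓ} (P? : Decidable P) xs →
                      length xs ≡ length (filter P? xs) + length (filter (¬? ∘ P?) xs)
length-filter-split P? []       = refl
length-filter-split P? (x ∷ xs) with P? x
... | yes _ = cong suc (length-filter-split P? xs)
... | no  _ = trans (cong suc (length-filter-split P? xs)) (sym (+-suc _ _))

-- Arithmetic of the final estimate

module _ {Q s α α′ β γ τ : ℕ} .{{_ : NonZero Q}} .{{_ : NonZero s}}
  -- Here `α`, `β`, `γ`, `τ` stand for the sizes of A, B, C and the image, and `α′` for the number
  -- of a in A whose transpose is outside `singular`.
  (large : 8 * s * (Q * Q) ≤ α * β * γ) (α≤α′+s : α ≤ α′ + s) (β≤Q : β ≤ Q) (γ≤Q : γ ≤ Q)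
  (bound : 2 * τ ≤ Q → α′ * (γ * (Q * β * (Q * β))) ≤ 4 * (Q * Q * (β * (Q * τ * s)))) where

  -- B and C contribute at most Q² to the product, so A has to supply the rest.
  8s≤α : 8 * s ≤ α
  8s≤α = *-cancelʳ-≤ (8 * s) α (Q * Q) {{m*n≢0 Q Q}} (begin
    8 * s * (Q * Q)  ≤⟨ large ⟩
    α * β * γ        ≡⟨ *-assoc α β γ ⟩
    α * (β * γ)      ≤⟨ *-monoʳ-≤ α (*-mono-≤ β≤Q γ≤Q) ⟩
    α * (Q * Q)      ∎)
    where open ≤-Reasoning

  -- At most s elements are discarded, and s is at most α/8, so at least half of A survives.
  α≤2α′ : α ≤ 2 * α′
  α≤2α′ = +-cancelʳ-≤ α α (2 * α′) (begin
    α + α                    ≡⟨ e₁ α ⟩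
    2 * α                    ≤⟨ *-monoʳ-≤ 2 α≤α′+s ⟩
    2 * (α′ + s)             ≡⟨ *-distribˡ-+ 2 α′ s ⟩
    2 * α′ + 2 * s           ≤⟨ +-monoʳ-≤ (2 * α′) (≤-trans (*-monoˡ-≤ s {2} {8} (s≤s (s≤s z≤n))) 8s≤α) ⟩
    2 * α′ + α               ∎)
    where
    open ≤-Reasoning
    e₁ : ∀ a → a + a ≡ 2 * a
    e₁ = solve-∀

  -- Otherwise the product in `large` would vanish; this permits cancelling β below.
  β≢0 : NonZero β
  β≢0 = ≢-nonZero λ β≡0 → <⇒≱ (>-nonZero⁻¹ (8 * s * (Q * Q)) {{m*n≢0 (8 * s) (Q * Q) {{m*n≢0 8 s}} {{m*n≢0 Q Q}}}})
    (≤-trans large (≤-reflexive (cong (_* γ) (trans (cong (α *_) β≡0) (*-zeroʳ α)))))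

  -- If 2τ ≤ Q, then `large` and `bound` combine to K Q ≤ K τ, hence even Q ≤ τ. The 8 in `large` is
  -- the 4 of `bound` times the 2 lost in `α≤2α′`.
  Q≤2τ : Q ≤ 2 * τ
  Q≤2τ with ≤-total Q (2 * τ)
  ... | inj₁ Q≤2τ = Q≤2τ
  ... | inj₂ 2τ≤Q = ≤-trans (*-cancelˡ-≤ K {{K≢0}} (begin
    K * Q                                      ≡⟨ e₁ Q s β ⟩
    8 * s * (Q * Q) * (β * (Q * Q))            ≤⟨ *-monoˡ-≤ (β * (Q * Q)) (≤-trans large (*-monoˡ-≤ γ (*-monoˡ-≤ β α≤2α′))) ⟩
    2 * α′ * β * γ * (β * (Q * Q))             ≡⟨ e₂ Q α′ β γ ⟩
    2 * (α′ * (γ * (Q * β * (Q * β))))         ≤⟨ *-monoʳ-≤ 2 (bound 2τ≤Q) ⟩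
    2 * (4 * (Q * Q * (β * (Q * τ * s))))      ≡⟨ e₃ Q s β τ ⟩
    K * τ                                      ∎)) (m≤n*m τ 2)
    where
    open ≤-Reasoning
    K = 8 * s * (Q * Q) * (β * Q)
    K≢0 : NonZero K
    K≢0 = m*n≢0 _ _ {{m*n≢0 _ _ {{m*n≢0 8 s}} {{m*n≢0 Q Q}}}} {{m*n≢0 β Q {{β≢0}}}}
    e₁ : ∀ q s b → 8 * s * (q * q) * (b * q) * q ≡ 8 * s * (q * q) * (b * (q * q))
    e₁ = solve-∀
    e₂ : ∀ q a b c → 2 * a * b * c * (b * (q * q)) ≡ 2 * (a * (c * (q * b * (q * b))))
    e₂ = solve-∀
    e₃ : ∀ q s b t → 2 * (4 * (q * q * (b * (q * t * s)))) ≡ 8 * s * (q * q) * (b * q) * t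
    e₃ = solve-∀

-- Application to the image set

module _ (F : FiniteField) {m : ℕ} where
  open FiniteField F using (order; elements-complete; 0#)
  open Matrices F
  open MatrixAlgebra F
  private
    n = suc m
    open import Data.List.Membership.DecPropositional (_≟M_ {n}) using (_∈?_)
    open Incidences (_≟M_ {n}) _+M_ _*M_ -M_ 0M +M-isAbelianGroup *M-distribˡ-+M
      matrices matrices-unique matrices-complete singular nonsingular-cancelʳ using (image-bound)

  fImage-∈ : ∀ {A B C : List (Mat n)} {a b c} → a ∈ A → b ∈ B → c ∈ C → fMat a b c ∈ fImage A B C
  fImage-∈ a∈ b∈ c∈ = ∈-deduplicate⁺ _≟M_
    (∈-cartesianProductWith⁺ (λ a bc → bc a) a∈ (∈-cartesianProductWith⁺ (λ b c a → fMat a b c) b∈ c∈))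

  order≢0 : NonZero order
  order≢0 with FiniteField.elements F | elements-complete 0#
  ... | _ ∷ _ | _ = _

  ∣fImage∣-bound : ∀ (A B C : List (Mat n)) → Unique A → Unique B → Unique C →
    8 * n * order ^ (3 * (n * n) ∸ 1) ≤ length A * length B * length C →
    order ^ (n * n) ≤ 2 * ∣fImage∣ A B C
  ∣fImage∣-bound A B C uA uB uC large = subst (_≤ 2 * ∣fImage∣ A B C) length-matrices
    (Q≤2τ {{Q≢0}} {{s≢0}} large′ split (size≤ uB) (size≤ uC)
      (image-bound (fImage A B C) (UniqueDec.deduplicate-! _≟M_ _) B uB A′ C
        (Unique.filter⁺ (¬? ∘ bad?) uA) uC
        (λ {a} a∈ → nonsingularᵀ-cancelˡ {X = a} (proj₂ (∈-filter⁻ (¬? ∘ bad?) {xs = A} a∈)))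
        (λ a∈ → fImage-∈ (proj₁ (∈-filter⁻ (¬? ∘ bad?) {xs = A} a∈)))))
    where
    -- The elements of A multiply from the left, so their transposes are tested.
    bad? : Decidable (λ (a : Mat n) → (a ᵀ) ∈ singular)
    bad? a = (a ᵀ) ∈? singular
    A′ = filter (¬? ∘ bad?) A
    instance
      q≢0 : NonZero order
      q≢0 = order≢0
    Q≢0 : NonZero (length (matrices {n}))
    Q≢0 = subst NonZero (sym (length-matrices {n})) (m^n≢0 order (n * n))
    s≢0 : NonZero (length (singular {m}))
    s≢0 = subst NonZero (sym (length-singular {m})) (m*n≢0 n _ {{_}} {{m^n≢0 order (m + suc m * m)}})
    size≤ : ∀ {xs : List (Mat n)} → Unique xs → length xs ≤ length (matrices {n})
    size≤ u = length-⊆ u (λ _ → matrices-complete _)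
    split : length A ≤ length A′ + length (singular {m})
    split = begin
      length A                              ≡⟨ length-filter-split bad? A ⟩
      length (filter bad? A) + length A′    ≡⟨ +-comm _ (length A′) ⟩
      length A′ + length (filter bad? A)
        ≤⟨ +-monoʳ-≤ (length A′) (length-injective (Unique.filter⁺ bad? uA) ᵀ-injective
             (λ a∈ → proj₂ (∈-filter⁻ bad? {xs = A} a∈))) ⟩
      length A′ + length (singular {m})     ∎
      where open ≤-Reasoning
    power : 8 * length (singular {m}) * (length (matrices {n}) * length (matrices {n}))
          ≡ 8 * n * order ^ (3 * (n * n) ∸ 1)
    power = begin
      8 * length (singular {m}) * (length (matrices {n}) * length (matrices {n}))
        ≡⟨ cong₂ (λ s Q → 8 * s * (Q * Q)) (length-singular {m}) (length-matrices {n}) ⟩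
      8 * (n * order ^ k) * (order ^ (n * n) * order ^ (n * n))
        ≡⟨ e n (order ^ k) (order ^ (n * n)) ⟩
      8 * n * (order ^ k * (order ^ (n * n) * (order ^ (n * n) * 1)))
        ≡⟨ cong (λ x → 8 * n * (order ^ k * x))
             (sym (trans (^-distribˡ-+-* order (n * n) (n * n + 0))
                         (cong (order ^ (n * n) *_) (^-distribˡ-+-* order (n * n) 0)))) ⟩
      8 * n * (order ^ k * order ^ (n * n + (n * n + 0)))
        ≡⟨ cong (8 * n *_) (^-distribˡ-+-* order k (n * n + (n * n + 0))) ⟨
      8 * n * order ^ (k + (n * n + (n * n + 0)))
        -- The right side now holds by computation: `3 *` unfolds into three summands and a trailing
        -- 0, and `n = suc m` exposes a successor in the first `n * n`, which `∸ 1` removes.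
        ≡⟨ cong (λ i → 8 * n * order ^ (m + i + (n * n + (n * n + 0)))) (*-comm n m) ⟩
      8 * n * order ^ (3 * (n * n) ∸ 1) ∎
      where
      open ≡-Reasoning
      k = m + suc m * m
      e : ∀ n x y → 8 * (n * x) * (y * y) ≡ 8 * n * (x * (y * (y * 1)))
      e = solve-∀
    large′ : 8 * length (singular {m}) * (length (matrices {n}) * length (matrices {n}))
             ≤ length A * length B * length C
    large′ = subst (_≤ length A * length B * length C) (sym power) large

-- Inequalities between rationals and naturals

/-≃ : ∀ a d → toℚᵘ (+ a / suc d) ℚᵘ.≃ ℚᵘ.mkℚᵘ (+ a) d
/-≃ a d = ℚ.toℚᵘ-fromℚᵘ (ℚᵘ.mkℚᵘ (+ a) d)

-- The comparison is made in ℚᵘ, where a product is formed from numerators and denominators without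
-- reduction to lowest terms.
/-*-≃ : ∀ a d x → toℚᵘ ((+ a / suc d) Q.* (+ x / 1)) ℚᵘ.≃ ℚᵘ.mkℚᵘ (+ (a * x)) d
/-*-≃ a d x = ℚᵘ.≃-trans (ℚ.toℚᵘ-homo-* (+ a / suc d) (+ x / 1))
  (ℚᵘ.≃-trans (ℚᵘ.*-cong (/-≃ a d) (/-≃ x 0))
    (ℚᵘ.*≡* (cong₂ ℤ._*_ (sym (ℤ.pos-* a x)) (cong +_ (sym (*-identityʳ (suc d)))))))

/-*-cancel-≤ : ∀ a x y → (+ a / 1) Q.* (+ x / 1) Q.≤ (+ y / 1) → a * x ≤ y
/-*-cancel-≤ a x y le
  with ℚᵘ.*≤* r ← ℚᵘ.≤-respˡ-≃ (/-*-≃ a 0 x) (ℚᵘ.≤-respʳ-≃ (/-≃ y 0) (ℚ.toℚᵘ-mono-≤ le)) =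
  ℤ.drop‿+≤+ (subst₂ ℤ._≤_ (ℤ.*-identityʳ (+ (a * x))) (ℤ.*-identityʳ (+ y)) r)

/-*-mono-≤ : ∀ a d x y → a * x ≤ suc d * y → (+ a / suc d) Q.* (+ x / 1) Q.≤ (+ y / 1)
/-*-mono-≤ a d x y le = ℚ.toℚᵘ-cancel-≤
  (ℚᵘ.≤-respˡ-≃ (ℚᵘ.≃-sym (/-*-≃ a d x)) (ℚᵘ.≤-respʳ-≃ (ℚᵘ.≃-sym (/-≃ y 0))
    (ℚᵘ.*≤* (subst₂ ℤ._≤_ (sym (ℤ.*-identityʳ (+ (a * x))))
      (trans (cong +_ (*-comm (suc d) y)) (ℤ.pos-* y (suc d))) (ℤ.+≤+ le)))))

theorem1p9 : (n : ℕ) → .{{_ : NonZero n}} →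
    Σ ℚ λ C₀ → Σ ℚ λ c → Positive C₀ × Positive c ×
    ((F : FiniteField) → OddPrimePower (FiniteField.order F) →
    let open Matrices F in
    (A B C : List (Mat n)) → Unique A → Unique B → Unique C →
    C₀ Q.* ((+ (FiniteField.order F ^ (3 * (n * n) ∸ 1))) / 1)
    Q.≤ ((+ (length A * length B * length C)) / 1) →
    c Q.* ((+ (FiniteField.order F ^ (n * n))) / 1) Q.≤ ((+ ∣fImage∣ A B C) / 1))
theorem1p9 (suc m) =
  -- C₀ = 8n combines the 8 of `large` with the factor n of `length-singular`; c = 1/2 comes from
  -- the threshold 2τ ≤ Q. Both depend on n alone.
  + (8 * suc m) / 1 , + 1 / 2 , ℚ.normalize-pos (8 * suc m) 1 , _ ,
  λ F _ A B C A-unique B-unique C-unique large →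
    let q = FiniteField.order F
        n = suc m
        τ = Matrices.∣fImage∣ F A B C
    -- The arguments `1 1` encode the fraction 1/2, whose denominator is `suc 1`.
    in /-*-mono-≤ 1 1 (q ^ (n * n)) τ (subst (_≤ 2 * τ) (sym (*-identityˡ (q ^ (n * n))))
         (∣fImage∣-bound F A B C A-unique B-unique C-unique
           (/-*-cancel-≤ (8 * n) (q ^ (3 * (n * n) ∸ 1)) (length A * length B * length C) large)))
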